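{- Let $q=p^{k}$ be a power of a prime $p$ (with $k\geq 1$). Then $\mathbb{F}_{q}[[t]]$ is existentially definable in $\mathbb{F}_{q}((t))$ using no parameters; that is, there is an existential $\mathcal{L}_{\mathrm{ring}}$-formula $\chi(x)$ without parameters such that, for every $a\in\mathbb{F}_{q}((t))$, $\mathbb{F}_{q}((t))\models\chi(a)$ if and only if $a\in\mathbb{F}_{q}[[t]]$.
   Context: $\mathcal{L}_{\mathrm{ring}}$ is the first-order language of rings. $\mathbb{F}_{q}((t))$ is the field of formal power (Laurent) series over the finite field $\mathbb{F}_{q}$ with $q$ elements, and $\mathbb{F}_{q}[[t]]$ is its subring of formal power series, i.e. the valuation ring of the $t$-adic valuation. The formula $\chi$ is allowed to depend on $q$. -}

module Defs where

open import Level using (Level; _⊔_; Lift) renaming (suc to lsuc)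
open import Algebra.Bundles using (CommutativeRing)
open import Algebra.Bundles.Raw using (RawRing)
import Algebra.Definitions as AlgebraDefinitions
import Algebra.Properties.CommutativeMonoid.Sum as Summation
open import Data.Fin.Base using (Fin; toℕ)
open import Data.Integer.Base as ℤ using (ℤ; +_; -[1+_])
open import Data.Nat.Base as ℕ using (ℕ; zero; suc; _∸_)
open import Data.Product.Base using (Σ-syntax; _×_)
open import Data.Sum.Base using (_⊎_)
open import Data.Vec.Base using (Vec; _∷_; lookup)
open import Function.Bundles using (Inverse)
import Relation.Binary.PropositionalEquality.Properties as ≡
open import Relation.Nullary.Negation.Core using (¬_)

private variable
  c ℓ : Level
  n : ℕ

infix  8 ⊝_
infixl 7 _⊗_
infixl 6 _⊕_
infix  5 _≐_
infixr 4 ¬ᶠ_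
infixr 3 _∧ᶠ_
infixr 2 _∨ᶠ_
infixr 1 _⇒ᶠ_
infixr 0 ∃ᶠ_ ∀ᶠ_

-- The language of rings is {0, 1, +, ·, −}.  Variables are de Bruijn
-- indices: `Formula n` has at most n free variables, and there are no
-- constant symbols besides 0 and 1, so no formula has parameters.
data Term (n : ℕ) : Set where
  var     : Fin n → Term n
  𝟘 𝟙     : Term n
  _⊕_ _⊗_ : Term n → Term n → Term n
  ⊝_      : Term n → Term n

data Formula (n : ℕ) : Set where
  _≐_               : Term n → Term n → Formula n
  ¬ᶠ_               : Formula n → Formula n
  _∧ᶠ_ _∨ᶠ_ _⇒ᶠ_    : Formula n → Formula n → Formula n
  ∃ᶠ_ ∀ᶠ_           : Formula (suc n) → Formula n

data QuantifierFree {n : ℕ} : Formula n → Set where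
  atom : ∀ s t → QuantifierFree (s ≐ t)
  neg  : ∀ {φ} → QuantifierFree φ → QuantifierFree (¬ᶠ φ)
  and  : ∀ {φ ψ} → QuantifierFree φ → QuantifierFree ψ → QuantifierFree (φ ∧ᶠ ψ)
  or   : ∀ {φ ψ} → QuantifierFree φ → QuantifierFree ψ → QuantifierFree (φ ∨ᶠ ψ)
  imp  : ∀ {φ ψ} → QuantifierFree φ → QuantifierFree ψ → QuantifierFree (φ ⇒ᶠ ψ)

-- ∃y₁ … ∃yₘ ψ with ψ quantifier-free.
data Existential {n : ℕ} : Formula n → Set where
  qf : ∀ {φ} → QuantifierFree φ → Existential φ
  ex : ∀ {φ} → Existential φ → Existential (∃ᶠ φ)

module _ (M : RawRing c ℓ) where
  open RawRing M

  ⟦_⟧ : Term n → Vec Carrier n → Carrier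
  ⟦ var i ⟧ ρ = lookup ρ i
  ⟦ 𝟘 ⟧     ρ = 0#
  ⟦ 𝟙 ⟧     ρ = 1#
  ⟦ s ⊕ t ⟧ ρ = ⟦ s ⟧ ρ + ⟦ t ⟧ ρ
  ⟦ s ⊗ t ⟧ ρ = ⟦ s ⟧ ρ * ⟦ t ⟧ ρ
  ⟦ ⊝ t ⟧   ρ = - ⟦ t ⟧ ρ

-- Tarski semantics, with the connectives read constructively and the
-- equality symbol interpreted as the setoid equality of M.  The newest
-- variable sits at the head of the environment.
infix 4 _⊨_[_]
_⊨_[_] : ∀ {c ℓ} (M : RawRing c ℓ) → Formula n → Vec (RawRing.Carrier M) n → Set (c ⊔ ℓ)
_⊨_[_] {c = c} M (s ≐ t) ρ = Lift c (RawRing._≈_ M (⟦ M ⟧ s ρ) (⟦ M ⟧ t ρ))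
M ⊨ (¬ᶠ φ)   [ ρ ] = ¬ (M ⊨ φ [ ρ ])
M ⊨ (φ ∧ᶠ ψ) [ ρ ] = (M ⊨ φ [ ρ ]) × (M ⊨ ψ [ ρ ])
M ⊨ (φ ∨ᶠ ψ) [ ρ ] = (M ⊨ φ [ ρ ]) ⊎ (M ⊨ ψ [ ρ ])
M ⊨ (φ ⇒ᶠ ψ) [ ρ ] = (M ⊨ φ [ ρ ]) → (M ⊨ ψ [ ρ ])
M ⊨ (∃ᶠ φ)   [ ρ ] = Σ[ x ∈ RawRing.Carrier M ] (M ⊨ φ [ x ∷ ρ ])
M ⊨ (∀ᶠ φ)   [ ρ ] = (x : RawRing.Carrier M) → M ⊨ φ [ x ∷ ρ ]

-- A field with exactly q elements up to its setoid equality.  The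
-- enumeration makes that equality decidable, so the usual field axiom
-- needs no apartness relation.
record FiniteField (q : ℕ) (c ℓ : Level) : Set (lsuc (c ⊔ ℓ)) where
  field
    commutativeRing : CommutativeRing c ℓ

  open CommutativeRing commutativeRing public
  open AlgebraDefinitions _≈_ using (Invertible)

  field
    0≉1         : ¬ (0# ≈ 1#)
    invertible  : ∀ x → ¬ (x ≈ 0#) → Invertible 1# _*_ x
    enumeration : Inverse setoid (≡.setoid (Fin q))

module LaurentSeries (R : CommutativeRing c ℓ) where
  open CommutativeRing R
  open Summation +-commutativeMonoid using (sum)

  -- ⟨ m , f ⟩ stands for the series Σ_{j ≥ 0} f(j) t^(j − m).  The
  -- representation is not unique: m only bounds the order of the pole.
  record Laurent : Set c where
    constructor ⟨_,_⟩
    field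
      pole   : ℕ
      series : ℕ → Carrier
  open Laurent public

  extendByZero : (ℕ → Carrier) → ℤ → Carrier
  extendByZero f (+ j)    = f j
  extendByZero f -[1+ _ ] = 0#

  coeff : Laurent → ℤ → Carrier
  coeff x i = extendByZero (series x) (i ℤ.+ + pole x)

  infix  8 -ᴸ_
  infixl 7 _*ᴸ_
  infixl 6 _+ᴸ_
  infix  4 _≈ᴸ_

  _≈ᴸ_ : Laurent → Laurent → Set ℓ
  x ≈ᴸ y = ∀ i → coeff x i ≈ coeff y i

  constant : Carrier → ℕ → Carrier
  constant a zero    = a
  constant a (suc _) = 0#

  -- Multiplication of a power series by t ^ d.
  shift : ℕ → (ℕ → Carrier) → ℕ → Carrier
  shift zero    f j       = f j
  shift (suc d) f zero    = 0#
  shift (suc d) f (suc j) = shift d f j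

  convolve : (ℕ → Carrier) → (ℕ → Carrier) → ℕ → Carrier
  convolve f g j = sum {suc j} (λ i → f (toℕ i) * g (j ∸ toℕ i))

  -- t^(−m) f and t^(−n) g are put over the common power t^(m + n).
  _+ᴸ_ : Laurent → Laurent → Laurent
  ⟨ m , f ⟩ +ᴸ ⟨ n , g ⟩ = ⟨ m ℕ.+ n , (λ j → shift n f j + shift m g j) ⟩

  _*ᴸ_ : Laurent → Laurent → Laurent
  ⟨ m , f ⟩ *ᴸ ⟨ n , g ⟩ = ⟨ m ℕ.+ n , convolve f g ⟩

  -ᴸ_ : Laurent → Laurent
  -ᴸ ⟨ m , f ⟩ = ⟨ m , (λ j → - f j) ⟩

  laurentRing : RawRing c ℓ
  laurentRing = record
    { Carrier = Laurent
    ; _≈_     = _≈ᴸ_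
    ; _+_     = _+ᴸ_
    ; _*_     = _*ᴸ_
    ; -_      = -ᴸ_
    ; 0#      = ⟨ 0 , constant 0# ⟩
    ; 1#      = ⟨ 0 , constant 1# ⟩
    }

  -- Membership in R[[t]]: every coefficient of negative degree vanishes.
  IsPowerSeries : Laurent → Set ℓ
  IsPowerSeries x = ∀ k → coeff x -[1+ k ] ≈ 0#

{-# OPTIONS --safe #-}

-- Let f(X) = X^q − X − 1.  By Fermat's little theorem f is constantly −1 on F_q.
-- Hence f(x) has constant term −1 for x ∈ F_q[[t]], while for x of order −d < 0
-- the term x^q dominates and f(x) has order −qd < 0.  So orders of values of f
-- are never positive, and f(a) f(x) = 1 forces f(a) to have order 0, that is,
-- a ∈ F_q[[t]].  Conversely, if a ∈ F_q[[t]], then f(a) f(x) = 1 can be solved for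
-- x ∈ t F_q[[t]] coefficient by coefficient, because f(x) = −1 − x + x^q and the
-- j-th coefficient of x^q only involves earlier coefficients of x.
-- The formula is therefore ∃x. f(a) f(x) = 1.
module Submission where

open import Defs
open import Algebra.Bundles using (CommutativeRing)
import Algebra.Properties.CommutativeMonoid.Sum as Summation
import Algebra.Properties.Ring as RingProperties
import Algebra.Properties.Semiring.Exp as Exponentiation
open import Data.Fin.Base using (Fin; zero; suc; punchIn)
open import Data.Fin.Permutation as Perm using (Permutation′; permutation; _⟨$⟩ʳ_)
open import Data.Fin.Properties using (punchInᵢ≢i) renaming (_≟_ to _≟ᶠ_)
open import Data.Integer.Base as ℤ using (ℤ; +_; -[1+_]; _⊖_)
import Data.Integer.Properties as ℤ
open import Data.Nat.Base as ℕ using (ℕ; zero; suc; z<s; s<s; s≤s; _≤_; _<_; _^_)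
import Data.Nat.Properties as ℕ
open import Data.Nat.Primality using (Prime)
open import Data.Product.Base using (Σ-syntax; _×_; _,_; proj₁; proj₂)
open import Data.Sum.Base as Sum using (_⊎_; inj₁; inj₂)
open import Data.Vec.Base using (Vec; _∷_; [])
open import Function.Base using (_∘_)
open import Function.Bundles using (_⇔_; mk⇔; Inverse)
open import Level using (Level; lift)
open import Relation.Binary.PropositionalEquality as ≡ using (_≡_)
import Relation.Binary.Reasoning.Setoid as SetoidReasoning
open import Relation.Nullary using (¬_; Dec; yes; no; contradiction)
open import Relation.Nullary.Decidable using (map′)

private variable
  c ℓ : Level
  n : ℕ

-- The defining formula

powᵗ : Term n → ℕ → Term n
powᵗ t zero    = 𝟙
powᵗ t (suc k) = t ⊗ powᵗ t k

module _ (q : ℕ) where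

  fᵗ : Term n → Term n
  fᵗ t = (powᵗ t q ⊕ ⊝ t) ⊕ ⊝ 𝟙

  χ : Formula 1
  χ = ∃ᶠ fᵗ (var (suc zero)) ⊗ fᵗ (var zero) ≐ 𝟙

-- Power series and Laurent series

i+[m+n]≡j⇒i+m≡j⊖n : ∀ i m n j → i ℤ.+ + (m ℕ.+ n) ≡ + j → i ℤ.+ + m ≡ j ⊖ n
i+[m+n]≡j⇒i+m≡j⊖n i m n j eq = begin
  i ℤ.+ + m                            ≡⟨ ℤ.+-identityʳ _ ⟨
  i ℤ.+ + m ℤ.+ + 0                    ≡⟨ ≡.cong (ℤ._+_ (i ℤ.+ + m)) (ℤ.+-inverseʳ (+ n)) ⟨
  i ℤ.+ + m ℤ.+ (+ n ℤ.+ ℤ.- + n)      ≡⟨ ℤ.+-assoc (i ℤ.+ + m) (+ n) (ℤ.- + n) ⟨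
  i ℤ.+ + m ℤ.+ + n ℤ.+ ℤ.- + n        ≡⟨ ≡.cong (ℤ._+ ℤ.- + n) (≡.trans (ℤ.+-assoc i (+ m) (+ n)) eq) ⟩
  + j ℤ.+ ℤ.- + n                      ≡⟨ ℤ.m-n≡m⊖n j n ⟩
  j ⊖ n                                ∎
  where open ≡.≡-Reasoning

module Series (R : CommutativeRing c ℓ) where
  open CommutativeRing R hiding (zero)
  open LaurentSeries R
  open RingProperties ring
  open Exponentiation semiring using () renaming (_^_ to _^ᴿ_)
  open SetoidReasoning setoid

  Series : Set _
  Series = ℕ → Carrier

  infix 4 _≋_ _≈[_]_ _∼_

  _≋_ : Series → Series → Set _
  f ≋ g = ∀ j → f j ≈ g j

  -- Congruence modulo `t ^ n`.
  _≈[_]_ : Series → ℕ → Series → Set _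
  f ≈[ n ] g = ∀ {j} → j < n → f j ≈ g j

  -- Powers of t and Cauchy products

  shift-cong : ∀ d {f g} → f ≋ g → shift d f ≋ shift d g
  shift-cong zero    f≋g j       = f≋g j
  shift-cong (suc d) f≋g zero    = refl
  shift-cong (suc d) f≋g (suc j) = shift-cong d f≋g j

  shift-≈[] : ∀ d {f g} → f ≈[ n ] g → shift d f ≈[ d ℕ.+ n ] shift d g
  shift-≈[] zero    f≈g j<n               = f≈g j<n
  shift-≈[] (suc d) f≈g {zero}  j<n       = refl
  shift-≈[] (suc d) f≈g {suc j} (s<s j<n) = shift-≈[] d f≈g j<n

  shift-+ : ∀ d e f j → shift (d ℕ.+ e) f j ≡ shift d (shift e f) j
  shift-+ zero    e f j       = ≡.refl
  shift-+ (suc d) e f zero    = ≡.refl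
  shift-+ (suc d) e f (suc j) = shift-+ d e f j

  shift-comm : ∀ d e f j → shift d (shift e f) j ≡ shift e (shift d f) j
  shift-comm d e f j = ≡.trans (≡.sym (shift-+ d e f j))
    (≡.trans (≡.cong (λ k → shift k f j) (ℕ.+-comm d e)) (shift-+ e d f j))

  shift-distrib-+ : ∀ d f g →
    shift d (λ j → f j + g j) ≋ (λ j → shift d f j + shift d g j)
  shift-distrib-+ zero    f g j       = refl
  shift-distrib-+ (suc d) f g zero    = sym (+-identityˡ 0#)
  shift-distrib-+ (suc d) f g (suc j) = shift-distrib-+ d f g j

  shift-neg : ∀ d f → shift d (λ j → - f j) ≋ (λ j → - shift d f j)
  shift-neg zero    f j       = refl
  shift-neg (suc d) f zero    = sym -0#≈0#
  shift-neg (suc d) f (suc j) = shift-neg d f j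

  -- Coefficient `suc j` unfolds to `f 0 * g (suc j) + convolve (f ∘ suc) g j`, so induction on the
  -- degree replaces `f` by its tail and keeps `g`.
  convolve-≈[] : ∀ {f f′ g g′} → f ≈[ n ] f′ → g ≈[ n ] g′ →
                 convolve f g ≈[ n ] convolve f′ g′
  convolve-≈[] f≈ g≈ {zero}  0<n       = +-congʳ (*-cong (f≈ 0<n) (g≈ 0<n))
  convolve-≈[] f≈ g≈ {suc j} (s<s j<n) =
    +-cong (*-cong (f≈ z<s) (g≈ (s<s j<n)))
           (convolve-≈[] (f≈ ∘ s<s) (g≈ ∘ ℕ.m<n⇒m<1+n) j<n)

  convolve-cong : ∀ {f f′ g g′} → f ≋ f′ → g ≋ g′ → convolve f g ≋ convolve f′ g′
  convolve-cong {f} {f′} {g} {g′} f≋ g≋ j =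
    convolve-≈[] {n = suc j} {f} {f′} {g} {g′} (λ _ → f≋ _) (λ _ → g≋ _) ℕ.≤-refl

  convolve-shift-sucˡ : ∀ f g → convolve (shift 1 f) g ≋ shift 1 (convolve f g)
  convolve-shift-sucˡ f g zero    = trans (+-identityʳ _) (zeroˡ _)
  convolve-shift-sucˡ f g (suc j) = trans (+-congʳ (zeroˡ _)) (+-identityˡ _)

  convolve-shift-sucʳ : ∀ f g → convolve f (shift 1 g) ≋ shift 1 (convolve f g)
  convolve-shift-sucʳ f g zero          = trans (+-identityʳ _) (zeroʳ _)
  -- In degree 1 the last summand meets the zero coefficient of `shift 1 g`; the resulting `0#` is
  -- the empty sum that ends `convolve f g 0`.
  convolve-shift-sucʳ f g (suc zero)    = +-congˡ (convolve-shift-sucʳ (f ∘ suc) g zero)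
  convolve-shift-sucʳ f g (suc (suc j)) = +-congˡ (convolve-shift-sucʳ (f ∘ suc) g (suc j))

  convolve-shiftˡ : ∀ d f g → convolve (shift d f) g ≋ shift d (convolve f g)
  convolve-shiftˡ zero    f g j = refl
  convolve-shiftˡ (suc d) f g j = begin
    convolve (shift (suc d) f) g j
      ≈⟨ convolve-cong {g = g} (λ i → reflexive (shift-+ 1 d f i)) (λ _ → refl) j ⟩
    convolve (shift 1 (shift d f)) g j   ≈⟨ convolve-shift-sucˡ (shift d f) g j ⟩
    shift 1 (convolve (shift d f) g) j   ≈⟨ shift-cong 1 (convolve-shiftˡ d f g) j ⟩
    shift 1 (shift d (convolve f g)) j   ≡⟨ shift-+ 1 d _ j ⟨
    shift (suc d) (convolve f g) j       ∎

  convolve-shiftʳ : ∀ d f g → convolve f (shift d g) ≋ shift d (convolve f g)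
  convolve-shiftʳ zero    f g j = refl
  convolve-shiftʳ (suc d) f g j = begin
    convolve f (shift (suc d) g) j
      ≈⟨ convolve-cong {f = f} (λ _ → refl) (λ i → reflexive (shift-+ 1 d g i)) j ⟩
    convolve f (shift 1 (shift d g)) j   ≈⟨ convolve-shift-sucʳ f (shift d g) j ⟩
    shift 1 (convolve f (shift d g)) j   ≈⟨ shift-cong 1 (convolve-shiftʳ d f g) j ⟩
    shift 1 (shift d (convolve f g)) j   ≡⟨ shift-+ 1 d _ j ⟨
    shift (suc d) (convolve f g) j       ∎

  convolve-shift : ∀ d e f g → convolve (shift d f) (shift e g) ≋ shift (d ℕ.+ e) (convolve f g)
  convolve-shift d e f g j = begin
    convolve (shift d f) (shift e g) j   ≈⟨ convolve-shiftˡ d f (shift e g) j ⟩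
    shift d (convolve f (shift e g)) j   ≈⟨ shift-cong d (convolve-shiftʳ e f g) j ⟩
    shift d (shift e (convolve f g)) j   ≡⟨ shift-+ d e _ j ⟨
    shift (d ℕ.+ e) (convolve f g) j     ∎

  infixr 8 _^ˢ_
  _^ˢ_ : Series → ℕ → Series
  f ^ˢ zero  = constant 1#
  f ^ˢ suc k = convolve f (f ^ˢ k)

  ^ˢ-≈[] : ∀ k {f g} → f ≈[ n ] g → (f ^ˢ k) ≈[ n ] (g ^ˢ k)
  ^ˢ-≈[] zero    f≈g _ = refl
  ^ˢ-≈[] (suc k) f≈g   = convolve-≈[] f≈g (^ˢ-≈[] k f≈g)

  ^ˢ-constantTerm : ∀ f k → (f ^ˢ k) 0 ≈ f 0 ^ᴿ k
  ^ˢ-constantTerm f zero    = refl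
  ^ˢ-constantTerm f (suc k) = trans (+-identityʳ _) (*-congˡ (^ˢ-constantTerm f k))

  shift1-^ˢ : ∀ f k → shift 1 f ^ˢ k ≋ shift k (f ^ˢ k)
  shift1-^ˢ f zero    j = refl
  shift1-^ˢ f (suc k) j = begin
    convolve (shift 1 f) (shift 1 f ^ˢ k) j     ≈⟨ convolve-cong {f = shift 1 f} (λ _ → refl) (shift1-^ˢ f k) j ⟩
    convolve (shift 1 f) (shift k (f ^ˢ k)) j   ≈⟨ convolve-shift 1 k f (f ^ˢ k) j ⟩
    shift (suc k) (f ^ˢ suc k) j                ∎

  -- Equality of Laurent series, cross-multiplied by powers of t.
  record _∼_ (x y : Laurent) : Set ℓ where
    constructor mk∼
    field crossMultiplied : shift (pole y) (series x) ≋ shift (pole x) (series y)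

  shift-extendByZero : ∀ d f j → shift d f j ≡ extendByZero f (j ⊖ d)
  shift-extendByZero zero    f j       = ≡.refl
  shift-extendByZero (suc d) f zero    = ≡.refl
  shift-extendByZero (suc d) f (suc j) = ≡.trans (shift-extendByZero d f j)
    (≡.cong (extendByZero f) (≡.sym (ℤ.[1+m]⊖[1+n]≡m⊖n j d)))

  -- Over the common denominator `t ^ (m + n)`, degree `i` sits at index `j` of the numerator
  -- `shift n f`.
  coeff-shift : ∀ i m n j f → i ℤ.+ + (m ℕ.+ n) ≡ + j →
                coeff ⟨ m , f ⟩ i ≡ shift n f j
  coeff-shift i m n j f eq = ≡.trans
    (≡.cong (extendByZero f) (i+[m+n]≡j⇒i+m≡j⊖n i m n j eq))
    (≡.sym (shift-extendByZero n f j))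

  coeff-below : ∀ i m n j f → i ℤ.+ + (m ℕ.+ n) ≡ -[1+ j ] → coeff ⟨ m , f ⟩ i ≡ 0#
  coeff-below i m n j f eq with i ℤ.+ + m in i+m
  ... | -[1+ _ ] = ≡.refl
  -- Adding `n` to a nonnegative `i + m` cannot give a negative integer.
  ... | + k with () ← ≡.trans (≡.cong (ℤ._+ + n) (≡.sym i+m)) (≡.trans (ℤ.+-assoc i (+ m) (+ n)) eq)

  ∼⇒≈ᴸ : ∀ {x y} → x ∼ y → x ≈ᴸ y
  ∼⇒≈ᴸ {⟨ m , f ⟩} {⟨ n , g ⟩} (mk∼ x∼y) i with i ℤ.+ + (m ℕ.+ n) in eq
  ... | + j = begin
    coeff ⟨ m , f ⟩ i   ≡⟨ coeff-shift i m n j f eq ⟩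
    shift n f j         ≈⟨ x∼y j ⟩
    shift m g j         ≡⟨ coeff-shift i n m j g (≡.trans (≡.cong (λ k → i ℤ.+ + k) (ℕ.+-comm n m)) eq) ⟨
    coeff ⟨ n , g ⟩ i   ∎
  ... | -[1+ j ] = begin
    coeff ⟨ m , f ⟩ i   ≡⟨ coeff-below i m n j f eq ⟩
    0#                  ≡⟨ coeff-below i n m j g (≡.trans (≡.cong (λ k → i ℤ.+ + k) (ℕ.+-comm n m)) eq) ⟨
    coeff ⟨ n , g ⟩ i   ∎

  ∼⟨0⟩⇒IsPowerSeries : ∀ {x f} → x ∼ ⟨ 0 , f ⟩ → IsPowerSeries x
  ∼⟨0⟩⇒IsPowerSeries x∼ k = ∼⇒≈ᴸ x∼ -[1+ k ]

  pole⇒¬IsPowerSeries : ∀ {x d f} → x ∼ ⟨ suc d , f ⟩ → ¬ (f 0 ≈ 0#) → ¬ IsPowerSeries x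
  pole⇒¬IsPowerSeries {x} {d} {f} x∼ f₀≉0 x∈O = f₀≉0 (begin
    f 0                              ≡⟨ ≡.cong (extendByZero f) (ℤ.n⊖n≡0 (suc d)) ⟨
    coeff ⟨ suc d , f ⟩ -[1+ d ]     ≈⟨ ∼⇒≈ᴸ x∼ -[1+ d ] ⟨
    coeff x -[1+ d ]                 ≈⟨ x∈O d ⟩
    0#                               ∎)

  ∼-respʳ-≋ : ∀ {x f g} → x ∼ ⟨ n , f ⟩ → f ≋ g → x ∼ ⟨ n , g ⟩
  ∼-respʳ-≋ {x = x} (mk∼ x∼) f≋g = mk∼ λ j → trans (x∼ j) (shift-cong (pole x) f≋g j)

  -- Expands the fraction by `t ^ d`, to bring summands over the same pole.
  ∼-rescale : ∀ d {x f} → x ∼ ⟨ n , f ⟩ → x ∼ ⟨ n ℕ.+ d , shift d f ⟩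
  ∼-rescale {n = n} d {⟨ m , f ⟩} {g} (mk∼ x∼) = mk∼ λ j → begin
    shift (n ℕ.+ d) f j     ≡⟨ shift-+ n d f j ⟩
    shift n (shift d f) j   ≡⟨ shift-comm n d f j ⟩
    shift d (shift n f) j   ≈⟨ shift-cong d x∼ j ⟩
    shift d (shift m g) j   ≡⟨ shift-comm d m g j ⟩
    shift m (shift d g) j   ∎

  -- `_+ᴸ_` adds the poles even when they agree; keeping the pole at `n` leaves the leading
  -- coefficient readable at index 0.
  +ᴸ-∼ : ∀ {x y f g} → x ∼ ⟨ n , f ⟩ → y ∼ ⟨ n , g ⟩ →
         x +ᴸ y ∼ ⟨ n , (λ j → f j + g j) ⟩
  +ᴸ-∼ {n = n} {⟨ m , f ⟩} {⟨ m′ , f′ ⟩} {g} {g′} (mk∼ x∼) (mk∼ y∼) = mk∼ λ j → begin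
    shift n (λ i → shift m′ f i + shift m f′ i) j           ≈⟨ shift-distrib-+ n _ _ j ⟩
    shift n (shift m′ f) j + shift n (shift m f′) j         ≡⟨ ≡.cong₂ _+_ (shift-comm n m′ f j) (shift-comm n m f′ j) ⟩
    shift m′ (shift n f) j + shift m (shift n f′) j         ≈⟨ +-cong (shift-cong m′ x∼ j) (shift-cong m y∼ j) ⟩
    shift m′ (shift m g) j + shift m (shift m′ g′) j        ≡⟨ ≡.cong (_+ _) (shift-comm m′ m g j) ⟩
    shift m (shift m′ g) j + shift m (shift m′ g′) j        ≡⟨ ≡.cong₂ _+_ (shift-+ m m′ g j) (shift-+ m m′ g′ j) ⟨
    shift (m ℕ.+ m′) g j + shift (m ℕ.+ m′) g′ j            ≈⟨ shift-distrib-+ (m ℕ.+ m′) g g′ j ⟨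
    shift (m ℕ.+ m′) (λ i → g i + g′ i) j                   ∎

  -ᴸ-∼ : ∀ {x f} → x ∼ ⟨ n , f ⟩ → -ᴸ x ∼ ⟨ n , (λ j → - f j) ⟩
  -ᴸ-∼ {n = n} {⟨ m , f ⟩} {g} (mk∼ x∼) = mk∼ λ j → begin
    shift n (λ i → - f i) j   ≈⟨ shift-neg n f j ⟩
    - shift n f j             ≈⟨ -‿cong (x∼ j) ⟩
    - shift m g j             ≈⟨ shift-neg m g j ⟨
    shift m (λ i → - g i) j   ∎

  *ᴸ-∼ : ∀ {x y d e f g} → x ∼ ⟨ d , f ⟩ → y ∼ ⟨ e , g ⟩ → x *ᴸ y ∼ ⟨ d ℕ.+ e , convolve f g ⟩
  *ᴸ-∼ {⟨ m , f ⟩} {⟨ m′ , f′ ⟩} {d} {e} {g} {g′} (mk∼ x∼) (mk∼ y∼) = mk∼ λ j → begin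
    shift (d ℕ.+ e) (convolve f f′) j        ≈⟨ convolve-shift d e f f′ j ⟨
    convolve (shift d f) (shift e f′) j      ≈⟨ convolve-cong x∼ y∼ j ⟩
    convolve (shift m g) (shift m′ g′) j     ≈⟨ convolve-shift m m′ g g′ j ⟩
    shift (m ℕ.+ m′) (convolve g g′) j       ∎

  module _ {k} (ρ : Vec Laurent k) (t : Term k) where

    powᵗ-∼ : ∀ {f} r → ⟦ laurentRing ⟧ t ρ ∼ ⟨ n , f ⟩ →
             ⟦ laurentRing ⟧ (powᵗ t r) ρ ∼ ⟨ r ℕ.* n , f ^ˢ r ⟩
    powᵗ-∼ zero    t∼ = mk∼ λ j → refl
    powᵗ-∼ (suc r) t∼   = *ᴸ-∼ t∼ (powᵗ-∼ r t∼)

  -- Pole or power series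

  NormalForm : Laurent → Set _
  NormalForm x =
    (Σ[ d ∈ ℕ ] Σ[ f ∈ Series ] x ∼ ⟨ suc d , f ⟩ × ¬ (f 0 ≈ 0#)) ⊎
    (Σ[ f ∈ Series ] x ∼ ⟨ 0 , f ⟩)

  -- Vanishing leading coefficients are stripped, each lowering the pole bound by one. At most `m`
  -- zero tests are made, so the case split is constructive.
  normalForm : (∀ a → Dec (a ≈ 0#)) → ∀ m f → NormalForm ⟨ m , f ⟩
  normalForm _≟0 zero    f = inj₂ (f , mk∼ λ _ → refl)
  normalForm _≟0 (suc m) f with f 0 ≟0
  ... | no  f₀≉0 = inj₁ (m , f , mk∼ (λ _ → refl) , f₀≉0)
  ... | yes f₀≈0 = Sum.map
      (λ (d , g , x∼ , g₀≉0) → d , g , step x∼ , g₀≉0)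
      (λ (g , x∼) → g , step x∼)
      (normalForm _≟0 m (f ∘ suc))
    where
    f≋ : f ≋ shift 1 (f ∘ suc)
    f≋ zero    = f₀≈0
    f≋ (suc j) = refl

    step : ∀ {g} → ⟨ m , f ∘ suc ⟩ ∼ ⟨ n , g ⟩ → ⟨ suc m , f ⟩ ∼ ⟨ n , g ⟩
    step {n = n} {g} (mk∼ x∼) = mk∼ λ j → begin
      shift n f j                       ≈⟨ shift-cong n {f} f≋ j ⟩
      shift n (shift 1 (f ∘ suc)) j     ≡⟨ shift-comm n 1 _ j ⟩
      shift 1 (shift n (f ∘ suc)) j     ≈⟨ shift-cong 1 x∼ j ⟩
      shift 1 (shift m g) j             ≡⟨ shift-+ 1 m g j ⟨
      shift (suc m) g j                 ∎

  -- Contraction principle for the t-adic metric.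
  module FixedPoint (Φ : Series → Series)
    (contraction : ∀ n {f g} → f ≈[ n ] g → Φ f n ≈ Φ g n) where

    iterate : ℕ → Series
    iterate zero    = λ _ → 0#
    iterate (suc k) = Φ (iterate k)

    -- Diagonal limit: coefficient `n` no longer changes from `iterate (suc n)` on.
    fix : Series
    fix n = iterate (suc n) n

    iterate-stable : ∀ k → iterate k ≈[ k ] iterate (suc k)
    iterate-stable (suc k) {j} (s<s j≤k) =
      contraction j (λ i<j → iterate-stable k (ℕ.<-≤-trans i<j j≤k))

    fix-iterate : ∀ k → fix ≈[ k ] iterate k
    fix-iterate (suc k) {j} (s≤s j≤k) with ℕ.m≤n⇒m<n∨m≡n j≤k
    ... | inj₁ j<k    = trans (fix-iterate k j<k) (iterate-stable k j<k)
    ... | inj₂ ≡.refl = refl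

    -- `fix n` is by definition `Φ (iterate n) n`, and `fix` agrees with `iterate n` below `n`.
    fix-fixed : fix ≋ Φ fix
    fix-fixed n = contraction n (sym ∘ fix-iterate n)

-- Finite fields

module FiniteFieldProperties {q} (F : FiniteField q c ℓ) where
  open FiniteField F hiding (zero)
  open Inverse enumeration using (to; from; to-cong; strictlyInverseʳ)
  -- Over the multiplicative monoid, `Π.sum` is a product.
  module Π = Summation *-commutativeMonoid
  open SetoidReasoning setoid

  to-injective : ∀ {x y} → to x ≡ to y → x ≈ y
  to-injective {x} {y} eq = begin
    x             ≈⟨ strictlyInverseʳ x ⟨
    from (to x)   ≡⟨ ≡.cong from eq ⟩
    from (to y)   ≈⟨ strictlyInverseʳ y ⟩
    y             ∎

  _≟0 : ∀ x → Dec (x ≈ 0#)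
  x ≟0 = map′ to-injective to-cong (to x ≟ᶠ to 0#)

  *-cancelˡ-≉0 : ∀ {x y z} → ¬ (x ≈ 0#) → x * y ≈ x * z → y ≈ z
  *-cancelˡ-≉0 {x} {y} {z} x≉0 xy≈xz = let x⁻¹ , x⁻¹x≈1 , _ = invertible x x≉0 in begin
    y               ≈⟨ *-identityˡ y ⟨
    1# * y          ≈⟨ *-congʳ x⁻¹x≈1 ⟨
    x⁻¹ * x * y     ≈⟨ *-assoc _ _ _ ⟩
    x⁻¹ * (x * y)   ≈⟨ *-congˡ xy≈xz ⟩
    x⁻¹ * (x * z)   ≈⟨ *-assoc _ _ _ ⟨
    x⁻¹ * x * z     ≈⟨ *-congʳ x⁻¹x≈1 ⟩
    1# * z          ≈⟨ *-identityˡ z ⟩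
    z               ∎

  *-≉0 : ∀ {x y} → ¬ (x ≈ 0#) → ¬ (y ≈ 0#) → ¬ (x * y ≈ 0#)
  *-≉0 x≉0 y≉0 xy≈0 = y≉0 (*-cancelˡ-≉0 x≉0 (trans xy≈0 (sym (zeroʳ _))))

  product-≉0 : ∀ (v : Fin n → Carrier) → (∀ i → ¬ (v i ≈ 0#)) → ¬ (Π.sum v ≈ 0#)
  product-≉0 {n = zero}  v v≉0 = 0≉1 ∘ sym
  product-≉0 {n = suc _} v v≉0 = *-≉0 (v≉0 zero) (product-≉0 (v ∘ suc) (v≉0 ∘ suc))

-- Multiplication by a ≠ 0 permutes the nonzero elements, so that a^(q−1) P = P
-- for their product P ≠ 0.
module Fermat {r} (F : FiniteField (suc r) c ℓ) where
  open FiniteField F hiding (zero)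
  open FiniteFieldProperties F
  open Inverse enumeration using (to; from; to-cong; strictlyInverseˡ; strictlyInverseʳ)
  open Exponentiation semiring using () renaming (_^_ to _^ᴿ_)
  open SetoidReasoning setoid

  nonzero : Fin r → Carrier
  nonzero i = from (punchIn (to 0#) i)

  nonzero-≉0 : ∀ i → ¬ (nonzero i ≈ 0#)
  nonzero-≉0 i eq = punchInᵢ≢i (to 0#) i (≡.trans (≡.sym (strictlyInverseˡ _)) (to-cong eq))

  module _ {a} (a≉0 : ¬ (a ≈ 0#)) where

    private
      a⁻¹ = proj₁ (invertible a a≉0)

      cancel : ∀ {x y} → x * y ≈ 1# → ∀ i → to (x * from (to (y * from i))) ≡ i
      cancel {x} {y} xy≈1 i = ≡.trans (to-cong (begin
        x * from (to (y * from i))   ≈⟨ *-congˡ (strictlyInverseʳ _) ⟩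
        x * (y * from i)             ≈⟨ *-assoc _ _ _ ⟨
        x * y * from i               ≈⟨ *-congʳ xy≈1 ⟩
        1# * from i                  ≈⟨ *-identityˡ _ ⟩
        from i                       ∎)) (strictlyInverseˡ i)

    multiplication : Permutation′ (suc r)
    multiplication = permutation (λ i → to (a * from i)) (λ i → to (a⁻¹ * from i))
      (cancel (proj₂ (proj₂ (invertible a a≉0)))) (cancel (proj₁ (proj₂ (invertible a a≉0))))

    -- Since the index of zero is fixed, deleting it and its image leaves a permutation of the
    -- nonzero elements.
    multiplication-zero : multiplication ⟨$⟩ʳ to 0# ≡ to 0#
    multiplication-zero = to-cong (trans (*-congˡ (strictlyInverseʳ 0#)) (zeroʳ a))

    multiplication≉0 : Permutation′ r
    multiplication≉0 = Perm.remove (to 0#) multiplication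

    nonzero-multiplication : ∀ i → nonzero (multiplication≉0 ⟨$⟩ʳ i) ≈ a * nonzero i
    nonzero-multiplication i = begin
      from (punchIn (to 0#) (multiplication≉0 ⟨$⟩ʳ i))
        -- `punchIn-permute` skips the image of the deleted index, so the skipped index is first
        -- rewritten as that image.
        ≡⟨ ≡.cong (λ z → from (punchIn z (multiplication≉0 ⟨$⟩ʳ i))) multiplication-zero ⟨
      from (punchIn (multiplication ⟨$⟩ʳ to 0#) (multiplication≉0 ⟨$⟩ʳ i))
        ≡⟨ ≡.cong from (Perm.punchIn-permute multiplication (to 0#) i) ⟨
      from (to (a * nonzero i))   ≈⟨ strictlyInverseʳ _ ⟩
      a * nonzero i               ∎

    a^r≈1 : a ^ᴿ r ≈ 1#
    a^r≈1 = *-cancelˡ-≉0 (product-≉0 nonzero nonzero-≉0) (begin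
      Π.sum nonzero * a ^ᴿ r                               ≈⟨ *-comm _ _ ⟩
      a ^ᴿ r * Π.sum nonzero                               ≈⟨ *-congʳ (Π.sum-replicate r) ⟨
      Π.sum {r} (λ _ → a) * Π.sum nonzero                  ≈⟨ Π.∑-distrib-+ (λ _ → a) nonzero ⟨
      Π.sum (λ i → a * nonzero i)                          ≈⟨ Π.sum-cong-≋ nonzero-multiplication ⟨
      Π.sum (λ i → nonzero (multiplication≉0 ⟨$⟩ʳ i))      ≈⟨ Π.sum-permute nonzero multiplication≉0 ⟨
      Π.sum nonzero                                        ≈⟨ *-identityʳ _ ⟨
      Π.sum nonzero * 1#                                   ∎)

  fermat : ∀ a → a ^ᴿ suc r ≈ a
  fermat a with a ≟0
  ... | yes a≈0 = trans (*-congʳ a≈0) (trans (zeroˡ _) (sym a≈0))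
  ... | no  a≉0 = trans (*-congˡ (a^r≈1 a≉0)) (*-identityʳ a)

-- The values of X^q − X − 1

module Definability {r} (F : FiniteField (2 ℕ.+ r) c ℓ) where
  open FiniteField F hiding (zero)
  open FiniteFieldProperties F
  open Fermat F
  open LaurentSeries commutativeRing
  open Series commutativeRing
  open RingProperties ring
  open SetoidReasoning setoid

  q : ℕ
  q = 2 ℕ.+ r

  fˢ : Series → Series
  fˢ g j = ((g ^ˢ q) j + - g j) + - constant 1# j

  fˢ-constantTerm : ∀ g → fˢ g 0 ≈ - 1#
  fˢ-constantTerm g = begin
    ((g ^ˢ q) 0 + - g 0) + - 1#   ≈⟨ +-congʳ (+-congʳ (trans (^ˢ-constantTerm g q) (fermat (g 0)))) ⟩
    (g 0 + - g 0) + - 1#          ≈⟨ +-congʳ (-‿inverseʳ (g 0)) ⟩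
    0# + - 1#                     ≈⟨ +-identityˡ _ ⟩
    - 1#                          ∎

  -1≉0 : ¬ (- 1# ≈ 0#)
  -1≉0 -1≈0 = 0≉1 (sym (-‿injective (trans -1≈0 (sym -0#≈0#))))

  constant-∼ : ∀ d → ⟨ 0 , constant 1# ⟩ ∼ ⟨ d , shift d (constant 1#) ⟩
  constant-∼ d = mk∼ λ _ → refl

  module _ {k} (ρ : Vec Laurent k) (t : Term k) where

    private
      x  = ⟦ laurentRing ⟧ t ρ
      fx = ⟦ laurentRing ⟧ (fᵗ q t) ρ

    fᵗ-powerSeries : ∀ {g} → x ∼ ⟨ 0 , g ⟩ → fx ∼ ⟨ 0 , fˢ g ⟩
    fᵗ-powerSeries {g} x∼ = +ᴸ-∼
      -- The power comes with pole `q * 0`, which is only propositionally 0.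
      (+ᴸ-∼ (≡.subst (λ d → ⟦ laurentRing ⟧ (powᵗ t q) ρ ∼ ⟨ d , g ^ˢ q ⟩) (ℕ.*-zeroʳ q)
                   (powᵗ-∼ ρ t q x∼))
             (-ᴸ-∼ x∼))
      (-ᴸ-∼ (constant-∼ 0))

    fᵗ-pole : ∀ {d g} → x ∼ ⟨ suc d , g ⟩ → ¬ (g 0 ≈ 0#) →
              Σ[ h ∈ Series ] fx ∼ ⟨ q ℕ.* suc d , h ⟩ × ¬ (h 0 ≈ 0#)
    fᵗ-pole {d} {g} x∼ g₀≉0 = h , fx∼ , λ h₀≈0 → g₀≉0 (trans (sym h₀≈g₀) h₀≈0)
      where
      h : Series
      h j = ((g ^ˢ q) j + - shift (suc r ℕ.* suc d) g j) + - shift (q ℕ.* suc d) (constant 1#) j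

      fx∼ : fx ∼ ⟨ q ℕ.* suc d , h ⟩
      fx∼ = +ᴸ-∼
        -- `q * suc d` unfolds to `suc d + suc r * suc d`, so `x` is rescaled by the difference of
        -- the poles.
        (+ᴸ-∼ (powᵗ-∼ ρ t q x∼) (-ᴸ-∼ (∼-rescale (suc r ℕ.* suc d) x∼)))
        (-ᴸ-∼ (constant-∼ (q ℕ.* suc d)))

      h₀≈g₀ : h 0 ≈ g 0
      h₀≈g₀ = begin
        -- Both shifts in `h` are by positive amounts, so only the power reaches index 0.
        ((g ^ˢ q) 0 + - 0#) + - 0#   ≈⟨ +-cong (+-congˡ -0#≈0#) -0#≈0# ⟩
        ((g ^ˢ q) 0 + 0#) + 0#       ≈⟨ trans (+-identityʳ _) (+-identityʳ _) ⟩
        (g ^ˢ q) 0                   ≈⟨ trans (^ˢ-constantTerm g q) (fermat (g 0)) ⟩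
        g 0                          ∎

    fᵗ-order≤0 : Σ[ d ∈ ℕ ] Σ[ h ∈ Series ] fx ∼ ⟨ d , h ⟩ × ¬ (h 0 ≈ 0#)
    fᵗ-order≤0 with normalForm _≟0 (pole x) (series x)
    ... | inj₁ (d , g , x∼ , g₀≉0) = q ℕ.* suc d , fᵗ-pole x∼ g₀≉0
    ... | inj₂ (g , x∼)            = 0 , fˢ g , fᵗ-powerSeries x∼ ,
      λ h₀≈0 → -1≉0 (trans (sym (fˢ-constantTerm g)) h₀≈0)

  -- Solving u · f(x) = 1 for x = ty

  module Solve (u : Series) (u₀≈-1 : u 0 ≈ - 1#) where

    -- The fixed-point equation y = Φ y says that coefficient j + 1 of u · f(ty)
    -- vanishes, solved for the term y_j coming from u₀ = −1.
    Φ : Series → Series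
    Φ y j = (shift 1 y ^ˢ q) (suc j) + - convolve (u ∘ suc) (fˢ (shift 1 y)) j

    -- `(ty)^q = t^q y^q`, and `q ≥ 2` gains at least two places of precision. Two are required
    -- because `Φ y n` contains the power's coefficient at `suc n`.
    ^q-contraction : ∀ n {y z} → y ≈[ n ] z → (shift 1 y ^ˢ q) ≈[ 2 ℕ.+ n ] (shift 1 z ^ˢ q)
    ^q-contraction n {y} {z} y≈z {j} j<2+n = begin
      (shift 1 y ^ˢ q) j      ≈⟨ shift1-^ˢ y q j ⟩
      shift q (y ^ˢ q) j      ≈⟨ shift-≈[] q (^ˢ-≈[] q y≈z) (ℕ.<-≤-trans j<2+n (s≤s (s≤s (ℕ.m≤n+m n r)))) ⟩
      shift q (z ^ˢ q) j      ≈⟨ shift1-^ˢ z q j ⟨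
      (shift 1 z ^ˢ q) j      ∎

    Φ-contraction : ∀ n {y z} → y ≈[ n ] z → Φ y n ≈ Φ z n
    Φ-contraction n y≈z = +-cong (^q-contraction n y≈z ℕ.≤-refl)
      -- This product involves `fˢ (shift 1 y)` up to degree `n`; its linear term there sees only
      -- the coefficients of `y` below `n`.
      (-‿cong (convolve-≈[] {n = suc n} {u ∘ suc} (λ _ → refl)
        (λ {j} j<1+n → +-congʳ {x = - constant 1# j} (+-cong (^q-contraction n y≈z (ℕ.m<n⇒m<1+n j<1+n))
                                   (-‿cong (shift-≈[] 1 y≈z j<1+n))))
        ℕ.≤-refl))

    open FixedPoint Φ Φ-contraction

    solution : Series
    solution = shift 1 fix

    solution-correct : convolve u (fˢ solution) ≋ constant 1#
    solution-correct zero    = begin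
      u 0 * fˢ solution 0 + 0#    ≈⟨ +-identityʳ _ ⟩
      u 0 * fˢ solution 0         ≈⟨ *-cong u₀≈-1 (fˢ-constantTerm solution) ⟩
      - 1# * - 1#                 ≈⟨ -1*x≈-x _ ⟩
      - (- 1#)                    ≈⟨ -‿involutive 1# ⟩
      1#                          ∎
    solution-correct (suc j) = begin
      -- The first summand of the product is split off: `solution (suc j)` is `fix j`, the constant
      -- 1 contributes `0#`, and `B` collects the remaining summands.
      u 0 * ((A + - fix j) + - 0#) + B   ≈⟨ +-congʳ (*-cong u₀≈-1 (trans (+-congˡ -0#≈0#) (+-identityʳ _))) ⟩
      - 1# * (A + - fix j) + B           ≈⟨ +-congʳ (*-congˡ A-fix≈B) ⟩
      - 1# * B + B                       ≈⟨ +-congʳ (-1*x≈-x B) ⟩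
      - B + B                            ≈⟨ -‿inverseˡ B ⟩
      0#                                 ∎
      where
      A = (solution ^ˢ q) (suc j)
      B = convolve (u ∘ suc) (fˢ solution) j

      A-fix≈B : A + - fix j ≈ B
      A-fix≈B = begin
        A + - fix j           ≈⟨ +-congˡ (-‿cong (fix-fixed j)) ⟩
        A + - (A + - B)       ≈⟨ +-congˡ (-‿+-comm A (- B)) ⟨
        A + (- A + - (- B))   ≈⟨ \\-leftDividesˡ A (- (- B)) ⟩
        - (- B)               ≈⟨ -‿involutive B ⟩
        B                     ∎

  -- The formula defines the power series

  definable : ∀ a → (laurentRing ⊨ χ q [ a ∷ [] ]) ⇔ IsPowerSeries a
  definable a = mk⇔ sound complete
    where
    sound : laurentRing ⊨ χ q [ a ∷ [] ] → IsPowerSeries a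
    sound (x , lift fafx≈1) with normalForm _≟0 (pole a) (series a)
    ... | inj₂ (_ , a∼)            = ∼⟨0⟩⇒IsPowerSeries a∼
    ... | inj₁ (_ , _ , a∼ , g₀≉0) =
      let ρ                  = x ∷ a ∷ []
          _ , fa∼ , h₀≉0     = fᵗ-pole ρ (var (suc zero)) a∼ g₀≉0
          _ , _ , fx∼ , k₀≉0 = fᵗ-order≤0 ρ (var zero)
      -- The series 1 has no terms of negative degree, whereas the product has a pole: its order is
      -- at least the positive one of f(a), and its leading coefficient is `h 0 * k 0` plus an empty
      -- sum, where `k` is the numerator of f(x).
      in contradiction (λ k → fafx≈1 -[1+ k ])
           (pole⇒¬IsPowerSeries (*ᴸ-∼ fa∼ fx∼)
             (*-≉0 h₀≉0 k₀≉0 ∘ trans (sym (+-identityʳ _))))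

    complete : IsPowerSeries a → laurentRing ⊨ χ q [ a ∷ [] ]
    complete a∈O with normalForm _≟0 (pole a) (series a)
    ... | inj₁ (_ , _ , a∼ , g₀≉0) = contradiction a∈O (pole⇒¬IsPowerSeries a∼ g₀≉0)
    ... | inj₂ (g , a∼) = x , lift (∼⇒≈ᴸ (∼-respʳ-≋
        (*ᴸ-∼ (fᵗ-powerSeries ρ (var (suc zero)) a∼)
              (fᵗ-powerSeries ρ (var zero) (mk∼ λ _ → refl)))
        solution-correct))
      where
      -- Here `u` is f(a), written as a power series.
      open Solve (fˢ g) (fˢ-constantTerm g)
      x = ⟨ 0 , solution ⟩
      ρ = x ∷ a ∷ []

-- Orders 0 and 1 are vacuous: `0#` has no index in `Fin 0`, and `Fin 1` would identify `0#` with
-- `1#`.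
definable : ∀ q → (F : FiniteField q c ℓ) →
  let open LaurentSeries (FiniteField.commutativeRing F) in
  ∀ a → (laurentRing ⊨ χ q [ a ∷ [] ]) ⇔ IsPowerSeries a
definable zero          F = contradiction (Inverse.to (FiniteField.enumeration F) (FiniteField.0# F)) λ ()
definable (suc zero)    F = contradiction (to-injective (fin1-irrelevant _ _)) (FiniteField.0≉1 F)
  where
  open FiniteFieldProperties F
  fin1-irrelevant : (i j : Fin 1) → i ≡ j
  fin1-irrelevant zero zero = ≡.refl
definable (suc (suc r)) F = Definability.definable F

theorem1p1 : ∀ {c ℓ} (p k : ℕ) → Prime p → 1 ≤ k →
    Σ[ χ ∈ Formula 1 ] (Existential χ ×
    (∀ (F : FiniteField (p ^ k) c ℓ) →
    let open LaurentSeries (FiniteField.commutativeRing F) in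
    ∀ (a : Laurent) → (laurentRing ⊨ χ [ a ∷ [] ]) ⇔ IsPowerSeries a))
theorem1p1 p k _ _ = χ (p ^ k) , ex (qf (atom _ _)) , definable (p ^ k)
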